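{- (Cut Elimination) The rule $\mathsf{ai}{\uparrow}$ is admissible for $\mathsf{MLSdli}$: for every proof in $\mathsf{MLSdli}\cup\{\mathsf{ai}{\uparrow}\}$ there is a proof in $\mathsf{MLSdli}$ with the same conclusion.
   Context: Structures. There are countably many atoms $a,b,c,\dots$; structures of multiplicative linear logic are generated by $R ::= a \mid \mathsf 1 \mid \bot \mid [R \wp R] \mid (R\otimes R) \mid \overline{R}$, where $\mathsf 1$ and $\bot$ (the units) are regarded as special atoms. $[R\wp T]$ is called a par structure, $(R\otimes T)$ a copar structure. Structures are considered modulo $\approx$, the smallest congruence induced by associativity and commutativity of $\wp$ and of $\otimes$ and by $\overline{[R\wp T]}\approx(\overline R\otimes\overline T)$, $\overline{(R\otimes T)}\approx[\overline R\wp\overline T]$, $\overline{\overline R}\approx R$, $\overline\bot\approx\mathsf 1$, $\overline{\mathsf 1}\approx\bot$; they are taken in negation normal form. A context $S\{\ \}$ is a structure with one hole not in the scope of a negation; $S\{R\}$ is the result of filling it with $R$; $S[R\wp T]$, $S(R\otimes T)$ abbreviate $S\{[R\wp T]\}$, $S\{(R\otimes T)\}$. $\mathsf{at}\,R$ is the set of atoms (including units; $a$ and $\overline a$ are different elements) occurring in $R$ in negation normal form. System $\mathsf{MLSdli}$ consists of the rules (for all contexts $S\{\ \}$, structures $R,T,U$, atoms $a$): - $\mathsf{ai}{\downarrow}$: premise $S\{\mathsf 1\}$, conclusion $S[a\wp\overline a]$. - $\mathsf u_1{\downarrow}$: premise $S\{R\}$, conclusion $S[R\wp\bot]$. - $\mathsf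 u_2{\downarrow}$: premise $S\{R\}$, conclusion $S(R\otimes\mathsf 1)$. - $\mathsf{dlis}$ (deep lazy interaction switch): premise $S([U\wp R]\otimes T)$, conclusion $S[U\wp(R\otimes T)]$, provided that $\mathsf{at}\,\overline R\cap\mathsf{at}\,U\neq\emptyset$, that $U$ is a copar structure or an atom different from $\bot$, and that $R$ is a par structure or an atom different from $\mathsf 1$. The atomic cut rule $\mathsf{ai}{\uparrow}$ has premise $S[R\wp(a\otimes\overline a)]$ and conclusion $S\{R\}$. A derivation in a system is a finite chain of instances of its rules (possibly none) leading from its top-most structure (premise) to its bottom-most structure (conclusion). A proof of $R$ is a derivation with premise $\mathsf 1$ and conclusion $R$. -}

module Defs where

open import Data.Nat using (ℕ)
open import Data.Product using (_×_; ∃-syntax)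
open import Data.Sum using (_⊎_)
open import Level using (0ℓ)
open import Relation.Binary.Core using (Rel)
open import Relation.Binary.PropositionalEquality using (_≢_)
open import Relation.Unary using (Pred; _∪_; ｛_｝; _≬_)

infixr 6 _⅋_
infixr 7 _⊗_
infix  8 ¬_

data Str : Set where
  var  : ℕ → Str
  𝟏 ⊥  : Str
  _⅋_  : Str → Str → Str
  _⊗_  : Str → Str → Str
  ¬_   : Str → Str

infix 4 _≈_

data _≈_ : Rel Str 0ℓ where
  ≈-refl  : ∀ {R} → R ≈ R
  ≈-sym   : ∀ {R T} → R ≈ T → T ≈ R
  ≈-trans : ∀ {R T U} → R ≈ T → T ≈ U → R ≈ U

  ⅋-cong : ∀ {R R′ T T′} → R ≈ R′ → T ≈ T′ → R ⅋ T ≈ R′ ⅋ T′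
  ⊗-cong : ∀ {R R′ T T′} → R ≈ R′ → T ≈ T′ → R ⊗ T ≈ R′ ⊗ T′
  ¬-cong : ∀ {R R′} → R ≈ R′ → ¬ R ≈ ¬ R′

  ⅋-assoc : ∀ R T U → (R ⅋ T) ⅋ U ≈ R ⅋ (T ⅋ U)
  ⅋-comm  : ∀ R T → R ⅋ T ≈ T ⅋ R
  ⊗-assoc : ∀ R T U → (R ⊗ T) ⊗ U ≈ R ⊗ (T ⊗ U)
  ⊗-comm  : ∀ R T → R ⊗ T ≈ T ⊗ R

  ¬-⅋ : ∀ R T → ¬ (R ⅋ T) ≈ ¬ R ⊗ ¬ T
  ¬-⊗ : ∀ R T → ¬ (R ⊗ T) ≈ ¬ R ⅋ ¬ T
  ¬-¬ : ∀ R → ¬ ¬ R ≈ R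
  ¬-⊥ : ¬ ⊥ ≈ 𝟏
  ¬-𝟏 : ¬ 𝟏 ≈ ⊥

-- Atoms as they occur in negation normal form: the units count as atoms,
-- and an atom and its negation are different elements.

data Atom : Set where
  pos neg : ℕ → Atom
  one bot : Atom

⌜_⌝ : Atom → Str
⌜ pos n ⌝ = var n
⌜ neg n ⌝ = ¬ var n
⌜ one ⌝   = 𝟏
⌜ bot ⌝   = ⊥

dual : Atom → Atom
dual (pos n) = neg n
dual (neg n) = pos n
dual one     = bot
dual bot     = one

data NNF : Set where
  atom    : Atom → NNF
  par cop : NNF → NNF → NNF

negate : NNF → NNF
negate (atom a)  = atom (dual a)
negate (par R T) = cop (negate R) (negate T)
negate (cop R T) = par (negate R) (negate T)

nnf : Str → NNF
nnf (var n) = atom (pos n)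
nnf 𝟏       = atom one
nnf ⊥       = atom bot
nnf (R ⅋ T) = par (nnf R) (nnf T)
nnf (R ⊗ T) = cop (nnf R) (nnf T)
nnf (¬ R)   = negate (nnf R)

atoms : NNF → Pred Atom 0ℓ
atoms (atom a)  = ｛ a ｝
atoms (par R T) = atoms R ∪ atoms T
atoms (cop R T) = atoms R ∪ atoms T

at : Str → Pred Atom 0ℓ
at R = atoms (nnf R)

-- The shape of a structure is read modulo ≈.

IsPar : Pred Str 0ℓ
IsPar R = ∃[ A ] ∃[ B ] R ≈ A ⅋ B

IsCopar : Pred Str 0ℓ
IsCopar R = ∃[ A ] ∃[ B ] R ≈ A ⊗ B

IsAtomOtherThan : Atom → Pred Str 0ℓ
IsAtomOtherThan u R = ∃[ a ] a ≢ u × R ≈ ⌜ a ⌝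

-- There is no constructor for negation: the hole is never in its scope.

data Ctx : Set where
  ∙         : Ctx
  _⅋ˡ_ _⊗ˡ_ : Ctx → Str → Ctx
  _⅋ʳ_ _⊗ʳ_ : Str → Ctx → Ctx

infix 9 _[_]

_[_] : Ctx → Str → Str
∙        [ R ] = R
(S ⅋ˡ T) [ R ] = S [ R ] ⅋ T
(S ⊗ˡ T) [ R ] = S [ R ] ⊗ T
(T ⅋ʳ S) [ R ] = T ⅋ S [ R ]
(T ⊗ʳ S) [ R ] = T ⊗ S [ R ]

-- A system relates the premise of each rule instance to its conclusion;
-- working modulo ≈ is left to derivations.

System : Set₁
System = Rel Str 0ℓ

data MLSdli : System where
  ai↓  : ∀ S a → MLSdli (S [ 𝟏 ]) (S [ ⌜ a ⌝ ⅋ ¬ ⌜ a ⌝ ])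
  u₁↓  : ∀ S R → MLSdli (S [ R ]) (S [ R ⅋ ⊥ ])
  u₂↓  : ∀ S R → MLSdli (S [ R ]) (S [ R ⊗ 𝟏 ])
  dlis : ∀ S R T U →
         at (¬ R) ≬ at U →
         IsCopar U ⊎ IsAtomOtherThan bot U →
         IsPar R ⊎ IsAtomOtherThan one R →
         MLSdli (S [ (U ⅋ R) ⊗ T ]) (S [ U ⅋ (R ⊗ T) ])

data AtomicCut : System where
  ai↑ : ∀ S R a → AtomicCut (S [ R ⅋ (⌜ a ⌝ ⊗ ¬ ⌜ a ⌝) ]) (S [ R ])

data Derivation (𝒮 : System) : System where
  stop : ∀ {P Q} → P ≈ Q → Derivation 𝒮 P Q
  step : ∀ {P P′ Q′ Q} → P ≈ P′ → 𝒮 P′ Q′ → Derivation 𝒮 Q′ Q →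
         Derivation 𝒮 P Q

Proof : System → Pred Str 0ℓ
Proof 𝒮 R = Derivation 𝒮 𝟏 R

{-# OPTIONS --safe #-}
module Submission where

-- Every rule, the cut included, is sound in the phase model over sequents
-- whose pole is provability in a focused, cut-free sequent calculus, and by
-- Okada's argument the model is complete for that calculus; this replaces
-- syntactic cut elimination.  It remains to show that each valid structure
-- other than 𝟏 is the conclusion of an MLSdli rule with a valid premise; such
-- premises have fewer pairs of atoms in the par relation, so iterating ends
-- in 𝟏.
--
-- The lazy interaction switch is the difficulty: in a proof of [Γ ⅋ (P ⊗ Q)],
-- the part of Γ used with P may share no atom with P.  Colour the formulas of
-- a provable sequent arbitrarily.  Then, unless it is 𝟏 alone, either two
-- formulas of different colours interact or a rule applies to formulas of one
-- colour.  By induction on focused proofs: decomposing P ⊗ Q, give P a new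
-- colour.  A rule application found in the premise of P is also one below
-- P ⊗ Q, and an interaction of P with U is one of P ⊗ Q with U, which the
-- switch can exploit if these two have the same colour.

open import Defs
open import Algebra.Bundles using (CommutativeMonoid)
import Algebra.Solver.CommutativeMonoid
open import Data.Nat using (ℕ; zero; suc; pred; _+_; _*_; _≤_; _<_; z<s)
open import Data.Nat.Induction using (<-wellFounded)
import Data.Nat.Properties as ℕ
open import Data.Nat.Tactic.RingSolver using (solve-∀)
open import Data.List.Base using (List; []; _∷_; _++_; map; foldl; foldr)
open import Data.List.Properties using (map-++; map-∘; map-id; ++-assoc; ++-identityʳ; foldl-++; ∷-injective)
open import Data.List.Membership.Propositional using (_∈_; _∉_)
open import Data.List.Membership.Propositional.Properties using (∈-∃++; ∈-map⁺; ∈-map⁻; ∈-++⁺ˡ; ∈-++⁻)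
open import Data.List.Relation.Binary.Permutation.Propositional using (_↭_; prep; swap; ↭-refl; ↭-sym; ↭-trans; refl; trans)
open import Data.List.Relation.Binary.Permutation.Propositional.Properties as ↭ using (++-commutativeMonoid; ↭-map-inv; ↭-singleton-inv; All-resp-↭; ∈-resp-↭; drop-∷; shift; ++⁺ʳ)
open import Data.List.Relation.Unary.All as All using (All; []; _∷_)
import Data.List.Relation.Unary.All.Properties as All
open import Data.List.Relation.Unary.Any using (here; there)
open import Data.Product using (_×_; _,_; proj₁; proj₂; ∃-syntax; map₁)
open import Data.Sum using (_⊎_; inj₁; inj₂)
open import Function using (_∘_; id)
open import Induction.WellFounded using (Acc; acc)
open import Level using (0ℓ)
open import Relation.Binary.Construct.Union using (_∪_)
open import Relation.Binary.Definitions using (_Respects_)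
open import Relation.Binary.PropositionalEquality as ≡ using (_≡_; _≢_; refl; cong; cong₂; subst)
open import Relation.Nullary using (Dec; yes; no; contradiction)
open import Relation.Unary using (Pred; ｛_｝; _⊆_; _≐_)

-- Phase semantics

module Phase (M : CommutativeMonoid 0ℓ 0ℓ)
             (Pole : Pred (CommutativeMonoid.Carrier M) 0ℓ)
             (resp : Pole Respects CommutativeMonoid._≈_ M) where

  open CommutativeMonoid M using (Carrier; ε; identityˡ; identityʳ; comm; ∙-congʳ)
    renaming (_∙_ to _·_; _≈_ to _≋_; sym to ≋-sym; refl to ≋-refl)
  open Algebra.Solver.CommutativeMonoid M using (solve; _⊜_; _⊕_) renaming (id to ε′)

  Region : Set₁
  Region = Pred Carrier 0ℓ

  infix  9 _ᗮ
  infixr 7 _⊗̇_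
  infixr 6 _⅋̇_

  _ᗮ : Region → Region
  (X ᗮ) x = ∀ {y} → X y → Pole (x · y)

  -- The connectives of phase semantics with the products unfolded: `X ⅋̇ Y` is the orthogonal of
  -- the product of `X ᗮ` and `Y ᗮ`. They are defined on all regions; closure is asked for, as
  -- `Fact`, where a law depends on it.
  _⅋̇_ _⊗̇_ : Region → Region → Region
  (X ⅋̇ Y) x = ∀ {y z} → (X ᗮ) y → (Y ᗮ) z → Pole (x · (y · z))
  X ⊗̇ Y = (X ᗮ ⅋̇ Y ᗮ) ᗮ

  Fact : Region → Set
  Fact X = X ᗮ ᗮ ⊆ X

  private variable
    X X′ Y Y′ Z : Region

  ᗮ-resp : (X ᗮ) Respects _≋_
  ᗮ-resp eq x∈ y∈ = resp (∙-congʳ eq) (x∈ y∈)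

  ᗮ-anti : X ⊆ Y → Y ᗮ ⊆ X ᗮ
  ᗮ-anti X⊆Y y∈ x∈ = y∈ (X⊆Y x∈)

  ᗮᗮ-intro : X ⊆ X ᗮ ᗮ
  ᗮᗮ-intro x∈ y∈ = resp (comm _ _) (y∈ x∈)

  ᗮ-fact : Fact (X ᗮ)
  ᗮ-fact = ᗮ-anti ᗮᗮ-intro

  ⅋̇-fact : Fact (X ⅋̇ Y)
  ⅋̇-fact x∈ y∈ z∈ = x∈ λ w∈ → resp (comm _ _) (w∈ y∈ z∈)

  ᗮ-cong : X ≐ Y → X ᗮ ≐ Y ᗮ
  ᗮ-cong (X⊆Y , Y⊆X) = ᗮ-anti Y⊆X , ᗮ-anti X⊆Y

  ⅋̇-mono : X ⊆ X′ → Y ⊆ Y′ → X ⅋̇ Y ⊆ X′ ⅋̇ Y′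
  ⅋̇-mono f g x∈ y∈ z∈ = x∈ (ᗮ-anti f y∈) (ᗮ-anti g z∈)

  ⅋̇-cong : X ≐ X′ → Y ≐ Y′ → X ⅋̇ Y ≐ X′ ⅋̇ Y′
  ⅋̇-cong (f , f′) (g , g′) = ⅋̇-mono f g , ⅋̇-mono f′ g′

  ⊗̇-mono : X ⊆ X′ → Y ⊆ Y′ → X ⊗̇ Y ⊆ X′ ⊗̇ Y′
  ⊗̇-mono f g = ᗮ-anti (⅋̇-mono (ᗮ-anti f) (ᗮ-anti g))

  ⅋̇-swap : X ⅋̇ Y ⊆ Y ⅋̇ X
  ⅋̇-swap x∈ {y} {z} y∈ z∈ = resp (solve 3 (λ a b c → a ⊕ (c ⊕ b) ⊜ a ⊕ (b ⊕ c)) ≋-refl _ y z) (x∈ z∈ y∈)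

  ⅋̇-comm : X ⅋̇ Y ≐ Y ⅋̇ X
  ⅋̇-comm {X} {Y} = ⅋̇-swap {X} {Y} , ⅋̇-swap {Y} {X}

  ⅋̇-assocʳ : (X ⅋̇ Y) ⅋̇ Z ⊆ X ⅋̇ (Y ⅋̇ Z)
  ⅋̇-assocʳ {x = x} x∈ {a} {b} a∈ b∈ =
    resp (solve 3 (λ x a b → b ⊕ (x ⊕ a) ⊜ x ⊕ (a ⊕ b)) ≋-refl x a b)
      (b∈ λ {c} {d} c∈ d∈ →
        resp (solve 4 (λ x a c d → x ⊕ ((a ⊕ c) ⊕ d) ⊜ (x ⊕ a) ⊕ (c ⊕ d)) ≋-refl x a c d)
          (x∈ (λ {w} w∈ → resp (comm _ _) (w∈ a∈ c∈)) d∈))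

  ⅋̇-assoc : (X ⅋̇ Y) ⅋̇ Z ≐ X ⅋̇ (Y ⅋̇ Z)
  ⅋̇-assoc {X} {Y} {Z} = ⅋̇-assocʳ {X} {Y} {Z} ,
    ⅋̇-mono {Y ⅋̇ X} {X ⅋̇ Y} {Z} {Z} (⅋̇-swap {Y} {X}) id
    ∘ ⅋̇-swap {Z} {Y ⅋̇ X}
    ∘ ⅋̇-assocʳ {Z} {Y} {X}
    ∘ ⅋̇-swap {X} {Z ⅋̇ Y}
    ∘ ⅋̇-mono {X} {X} {Y ⅋̇ Z} {Z ⅋̇ Y} id (⅋̇-swap {Y} {Z})

  𝟏̇ : Region
  𝟏̇ = Pole ᗮ

  ε∈𝟏̇ : 𝟏̇ ε
  ε∈𝟏̇ = resp (≋-sym (identityˡ _))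

  𝟏̇ᗮ⊆Pole : 𝟏̇ ᗮ ⊆ Pole
  𝟏̇ᗮ⊆Pole x∈ = resp (identityʳ _) (x∈ ε∈𝟏̇)

  ⅋̇-identityʳ⁻ : X ⊆ X ⅋̇ Pole
  ⅋̇-identityʳ⁻ {x = x} x∈ {y} {z} y∈ z∈ =
    resp (solve 3 (λ x y z → z ⊕ (y ⊕ x) ⊜ x ⊕ (y ⊕ z)) ≋-refl x y z) (z∈ (y∈ x∈))

  ⅋̇-identityʳ : Fact X → X ⅋̇ Pole ⊆ X
  ⅋̇-identityʳ fact x∈ = fact λ {y} y∈ →
    resp (solve 2 (λ x y → x ⊕ (y ⊕ ε′) ⊜ x ⊕ y) ≋-refl _ y) (x∈ y∈ ε∈𝟏̇)

  ⊗̇-intro : ∀ {x y} → X x → Y y → (X ⊗̇ Y) (x · y)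
  ⊗̇-intro {x = x} {y} x∈ y∈ {w} w∈ = resp (comm _ _) (w∈ (ᗮᗮ-intro x∈) (ᗮᗮ-intro y∈))

  -- Only generators have to be multiplied: closing `F` and `G` before taking the product adds
  -- nothing beyond the closure of the product. This carries the copar case of Okada's argument.
  ⊗̇-elim : ∀ {F G H : Region} → (∀ {x y} → F x → G y → H (x · y)) →
           X ⊆ F ᗮ ᗮ → Y ⊆ G ᗮ ᗮ → X ⊗̇ Y ⊆ H ᗮ ᗮ
  ⊗̇-elim FG⊆H X⊆F Y⊆G x∈ {w} w∈ = x∈ λ {y} {z} y∈ z∈ →
    resp (solve 3 (λ w y z → y ⊕ (w ⊕ z) ⊜ w ⊕ (y ⊕ z)) ≋-refl w y z)
      (y∈ λ p∈ → resp (comm _ _) (X⊆F p∈ λ {f} f∈ →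
        resp (solve 3 (λ w z f → z ⊕ (w ⊕ f) ⊜ (w ⊕ z) ⊕ f) ≋-refl w z f)
          (z∈ λ q∈ → resp (comm _ _) (Y⊆G q∈ λ {g} g∈ →
            resp (solve 3 (λ w f g → w ⊕ (f ⊕ g) ⊜ (w ⊕ f) ⊕ g) ≋-refl w f g)
              (w∈ (FG⊆H f∈ g∈))))))

  ⊗̇-identityʳ⁻ : X ⊆ X ⊗̇ 𝟏̇
  ⊗̇-identityʳ⁻ {X} x∈ = ᗮ-resp {(X ᗮ ⅋̇ 𝟏̇ ᗮ)} (identityʳ _) (⊗̇-intro {X} {𝟏̇} x∈ ε∈𝟏̇)

  switch : (X ⅋̇ Y) ⊗̇ Z ⊆ X ⅋̇ (Y ⊗̇ Z)
  switch {X} {Y} x∈ {y} {z} y∈ z∈ = x∈ λ {p} {q} p∈ q∈ →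
    resp (solve 4 (λ y z p q → z ⊕ ((p ⊕ y) ⊕ q) ⊜ (y ⊕ z) ⊕ (p ⊕ q)) ≋-refl y z p q)
      (⅋̇-fact z∈ (λ {r} r∈ → resp (solve 3 (λ p y r → p ⊕ (y ⊕ r) ⊜ (p ⊕ y) ⊕ r) ≋-refl p y r)
                    (⅋̇-fact {X} {Y} p∈ y∈ r∈))
                 q∈)

  excluded-middle : (X ⅋̇ X ᗮ) ε
  excluded-middle y∈ z∈ = resp (≋-sym (identityˡ _)) (resp (comm _ _) (z∈ y∈))

  -- `Pole` is the orthogonal of the singleton of `ε`, so `𝟏̇` is the closure of that singleton.
  -- Truth at `ε` thus becomes an inclusion, as the soundness of `ai↓` requires.
  𝟏̇-least : Fact X → X ε → 𝟏̇ ⊆ X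
  𝟏̇-least fact ε∈ x∈ = fact λ y∈ → x∈ (resp (identityʳ _) (y∈ ε∈))

  contradictory : X ⊗̇ X ᗮ ⊆ Pole
  contradictory {X} x∈ = resp (identityʳ _) (x∈ (excluded-middle {X ᗮ}))

  ⅋̇-cut : Fact Y → Y ⅋̇ (X ⊗̇ X ᗮ) ⊆ Y
  ⅋̇-cut {Y} {X} fact = ⅋̇-identityʳ fact ∘ ⅋̇-mono {Y} {Y} id (contradictory {X})

  ⊗̇-⅋̇-intro : ∀ {V W x y} → (X ⅋̇ V) x → (Y ⅋̇ W) y → ((X ⊗̇ Y) ⅋̇ (V ⅋̇ W)) (x · y)
  ⊗̇-⅋̇-intro {x = x} {y} x∈ y∈ {p} {q} p∈ q∈ =
    resp (solve 4 (λ x y p q → q ⊕ ((x ⊕ y) ⊕ p) ⊜ (x ⊕ y) ⊕ (p ⊕ q)) ≋-refl x y p q)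
      (q∈ λ {v} {w} v∈ w∈ →
        resp (solve 5 (λ x y p v w → p ⊕ ((x ⊕ v) ⊕ (y ⊕ w)) ⊜ ((x ⊕ y) ⊕ p) ⊕ (v ⊕ w)) ≋-refl x y p v w)
          (⅋̇-fact p∈ (split x∈ v∈) (split y∈ w∈)))
    where
    split : ∀ {X V x v} → (X ⅋̇ V) x → (V ᗮ) v → (X ᗮ ᗮ) (x · v)
    split {x = x} {v} x∈ v∈ {u} u∈ = resp (solve 3 (λ x v u → x ⊕ (u ⊕ v) ⊜ (x ⊕ v) ⊕ u) ≋-refl x v u) (x∈ u∈ v∈)

  ⅋̇* : List Region → Region
  ⅋̇* = foldr _⅋̇_ Pole

  Pole-fact : Fact Pole
  Pole-fact x∈ = 𝟏̇ᗮ⊆Pole x∈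

  ⅋̇*-fact : ∀ Xs → Fact (⅋̇* Xs)
  ⅋̇*-fact []       = Pole-fact
  ⅋̇*-fact (X ∷ Xs) = ⅋̇-fact {X} {⅋̇* Xs}

  ⅋̇*-++ : ∀ Xs Ys → ⅋̇* Xs ⅋̇ ⅋̇* Ys ⊆ ⅋̇* (Xs ++ Ys)
  ⅋̇*-++ []       Ys = ⅋̇-identityʳ (⅋̇*-fact Ys) ∘ ⅋̇-swap {Pole} {⅋̇* Ys}
  ⅋̇*-++ (X ∷ Xs) Ys = ⅋̇-mono {X} {X} id (⅋̇*-++ Xs Ys) ∘ ⅋̇-assocʳ {X} {⅋̇* Xs} {⅋̇* Ys}

  ⅋̇*-↭ : ∀ {Xs Ys} → Xs ↭ Ys → ⅋̇* Xs ⊆ ⅋̇* Ys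
  ⅋̇*-↭ refl                = id
  ⅋̇*-↭ {X ∷ Xs} (prep _ p) = ⅋̇-mono {X} {X} id (⅋̇*-↭ p)
  ⅋̇*-↭ {X ∷ Y ∷ Xs} {_ ∷ _ ∷ Ys} (swap _ _ p) =
    proj₁ (⅋̇-assoc {Y} {X} {⅋̇* Ys})
    ∘ ⅋̇-mono {X ⅋̇ Y} {Y ⅋̇ X} (⅋̇-swap {X} {Y}) (⅋̇*-↭ p)
    ∘ proj₂ (⅋̇-assoc {X} {Y} {⅋̇* Xs})
  ⅋̇*-↭ (trans p q)         = ⅋̇*-↭ q ∘ ⅋̇*-↭ p

  infix 4 ⊩_

  -- A record and not a synonym, so that `Xs` can be inferred: `⅋̇* Xs ε` unfolds to a function type
  -- from which the list cannot be read off.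
  record ⊩_ (Xs : List Region) : Set where
    constructor holds
    field proof : ⅋̇* Xs ε

  open ⊩_ public

  private variable
    Xs Ys : List Region

  ⊩-↭ : Xs ↭ Ys → ⊩ Xs → ⊩ Ys
  ⊩-↭ p (holds x∈) = holds (⅋̇*-↭ p x∈)

  ⊩-mono : X ⊆ Y → ⊩ X ∷ Xs → ⊩ Y ∷ Xs
  ⊩-mono {Xs = Xs} X⊆Y (holds x∈) = holds (⅋̇-mono {Y = ⅋̇* Xs} X⊆Y id x∈)

  ⊩-excluded-middle : ⊩ X ∷ X ᗮ ∷ []
  ⊩-excluded-middle {X} = holds (⅋̇-mono {X} id (⅋̇-identityʳ⁻ {X ᗮ}) (excluded-middle {X}))

  ⊩-𝟏̇ : ⊩ 𝟏̇ ∷ []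
  ⊩-𝟏̇ = holds (⅋̇-identityʳ⁻ {𝟏̇} ε∈𝟏̇)

  ⊩-Pole⁺ : ⊩ Xs → ⊩ Pole ∷ Xs
  ⊩-Pole⁺ {Xs} (holds x∈) = holds (⅋̇-swap {⅋̇* Xs} (⅋̇-identityʳ⁻ {⅋̇* Xs} x∈))

  ⊩-Pole⁻ : ⊩ Pole ∷ Xs → ⊩ Xs
  ⊩-Pole⁻ {Xs} (holds x∈) = holds (⅋̇-identityʳ (⅋̇*-fact Xs) (⅋̇-swap {Pole} {⅋̇* Xs} x∈))

  ⊩-⅋̇ : ⊩ X ∷ Y ∷ Xs → ⊩ X ⅋̇ Y ∷ Xs
  ⊩-⅋̇ {X} {Y} {Xs} (holds x∈) = holds (proj₂ (⅋̇-assoc {X} {Y} {⅋̇* Xs}) x∈)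

  ⊩-⊗̇ : ⊩ X ∷ Xs → ⊩ Y ∷ Ys → ⊩ X ⊗̇ Y ∷ Xs ++ Ys
  ⊩-⊗̇ {X} {Xs} {Y} {Ys} (holds x∈) (holds y∈) = holds
    (⅋̇-mono {X ⊗̇ Y} id (⅋̇*-++ Xs Ys) λ p∈ q∈ →
      resp (∙-congʳ (identityˡ ε)) (⊗̇-⅋̇-intro {X} {Y} {⅋̇* Xs} {⅋̇* Ys} x∈ y∈ p∈ q∈))

  ⊩-element : Fact X → ⊩ X ∷ [] → X ε
  ⊩-element fact (holds x∈) = ⅋̇-identityʳ fact x∈

-- Two sequent calculi

str : NNF → Str
str (atom a)  = ⌜ a ⌝
str (par A B) = str A ⅋ str B
str (cop A B) = str A ⊗ str B

components : NNF → List NNF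
components (par A B) = components A ++ components B
components A         = A ∷ []

-- These are the shapes that `dlis` admits for `R`. Ending the decomposition of a copar exactly at
-- them makes every factor found there a candidate for the switch.
data Passive : Pred NNF 0ℓ where
  atom : ∀ {a} → a ≢ one → Passive (atom a)
  par  : ∀ {A B} → Passive (par A B)

Sequent : Set
Sequent = List NNF

private variable
  A B F G P Q R U X : NNF
  Γ Δ : Sequent

-- In Focus A Γ the factors of A are decomposed until they are passive, and
-- the unit 𝟏 accepts no side formulas; pars are always fully decomposed.

infix 4 ⊢_

mutual
  data ⊢_ : Pred Sequent 0ℓ where
    perm  : Γ ↭ Δ → ⊢ Γ → ⊢ Δ
    ax    : ∀ n → ⊢ atom (pos n) ∷ atom (neg n) ∷ []
    unit  : ⊢ atom one ∷ []
    bot   : ⊢ Γ → ⊢ atom bot ∷ Γ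
    focus : Focus (cop A B) Γ → ⊢ cop A B ∷ Γ

  data Focus : NNF → Pred Sequent 0ℓ where
    unit  : Focus (atom one) []
    split : Focus A Γ → Focus B Δ → Focus (cop A B) (Γ ++ Δ)
    blur  : Passive A → ⊢ components A ++ Γ → Focus A Γ

-- A liberal calculus of rules sound in the phase model. With `conv` and `unbot` it certifies the
-- premises built below, which are not subproofs of the given proof.
data Valid : Pred Sequent 0ℓ where
  perm   : Γ ↭ Δ → Valid Γ → Valid Δ
  conv   : str A ≈ str B → Valid (A ∷ Γ) → Valid (B ∷ Γ)
  ax     : ∀ n → Valid (atom (pos n) ∷ atom (neg n) ∷ [])
  unit   : Valid (atom one ∷ [])
  bot    : Valid Γ → Valid (atom bot ∷ Γ)
  unbot  : Valid (atom bot ∷ Γ) → Valid Γ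
  par    : Valid (A ∷ B ∷ Γ) → Valid (par A B ∷ Γ)
  tensor : Valid (A ∷ Γ) → Valid (B ∷ Δ) → Valid (cop A B ∷ Γ ++ Δ)

components-valid : ∀ A {Γ} → Valid (components A ++ Γ) → Valid (A ∷ Γ)
components-valid (atom _)      v = v
components-valid (cop _ _)     v = v
components-valid (par A B) {Γ} v =
  par (perm (swap B A ↭-refl) (components-valid B (perm (↭-sym (shift A (components B) Γ))
    (components-valid A (subst Valid (++-assoc (components A) (components B) Γ) v)))))

mutual
  ⊢⇒Valid : ⊢ Γ → Valid Γ
  ⊢⇒Valid (perm p d) = perm p (⊢⇒Valid d)
  ⊢⇒Valid (ax n)     = ax n
  ⊢⇒Valid unit       = unit
  ⊢⇒Valid (bot d)    = bot (⊢⇒Valid d)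
  ⊢⇒Valid (focus f)  = Focus⇒Valid f

  Focus⇒Valid : Focus A Γ → Valid (A ∷ Γ)
  Focus⇒Valid unit        = unit
  Focus⇒Valid (split f g) = tensor (Focus⇒Valid f) (Focus⇒Valid g)
  Focus⇒Valid (blur _ d)  = components-valid _ (⊢⇒Valid d)

-- Completeness of the focused calculus

open Phase (++-commutativeMonoid {A = NNF}) ⊢_ perm

-- A variable denotes the sequents that are provable together with it.
⟦_⟧ : Str → Region
⟦ var n ⟧ = ｛ atom (pos n) ∷ [] ｝ ᗮ
⟦ 𝟏 ⟧     = 𝟏̇
⟦ ⊥ ⟧     = ⊢_
⟦ R ⅋ T ⟧ = ⟦ R ⟧ ⅋̇ ⟦ T ⟧
⟦ R ⊗ T ⟧ = ⟦ R ⟧ ⊗̇ ⟦ T ⟧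
⟦ ¬ R ⟧   = ⟦ R ⟧ ᗮ

⟦⟧-fact : ∀ R → Fact ⟦ R ⟧
⟦⟧-fact (var n) = ᗮ-fact
⟦⟧-fact 𝟏       = ᗮ-fact
⟦⟧-fact ⊥       = Pole-fact
⟦⟧-fact (R ⅋ T) = ⅋̇-fact {⟦ R ⟧} {⟦ T ⟧}
⟦⟧-fact (R ⊗ T) = ᗮ-fact
⟦⟧-fact (¬ R)   = ᗮ-fact

ᗮᗮ-≐ : ∀ R → ⟦ R ⟧ ᗮ ᗮ ≐ ⟦ R ⟧
ᗮᗮ-≐ R = ⟦⟧-fact R , ᗮᗮ-intro

≐-sym : ∀ {X Y : Region} → X ≐ Y → Y ≐ X
≐-sym (f , g) = g , f

≐-trans : ∀ {X Y Z : Region} → X ≐ Y → Y ≐ Z → X ≐ Z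
≐-trans (f , g) (f′ , g′) = f′ ∘ f , g ∘ g′

⟦⟧-≈ : ∀ {R T} → R ≈ T → ⟦ R ⟧ ≐ ⟦ T ⟧
⟦⟧-≈ ≈-refl = id , id
⟦⟧-≈ (≈-sym e) = ≐-sym (⟦⟧-≈ e)
⟦⟧-≈ (≈-trans e e′) = ≐-trans (⟦⟧-≈ e) (⟦⟧-≈ e′)
⟦⟧-≈ (⅋-cong e e′) = ⅋̇-cong (⟦⟧-≈ e) (⟦⟧-≈ e′)
⟦⟧-≈ (⊗-cong e e′) = ᗮ-cong (⅋̇-cong (ᗮ-cong (⟦⟧-≈ e)) (ᗮ-cong (⟦⟧-≈ e′)))
⟦⟧-≈ (¬-cong e) = ᗮ-cong (⟦⟧-≈ e)
⟦⟧-≈ (⅋-assoc R T U) = ⅋̇-assoc {⟦ R ⟧} {⟦ T ⟧} {⟦ U ⟧}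
⟦⟧-≈ (⅋-comm R T) = ⅋̇-comm {⟦ R ⟧} {⟦ T ⟧}
⟦⟧-≈ (⊗-assoc R T U) = ᗮ-cong (≐-trans (⅋̇-cong (⅋̇-fact {⟦ ¬ R ⟧} {⟦ ¬ T ⟧} , ᗮᗮ-intro) (id , id))
  (≐-trans (⟦⟧-≈ (⅋-assoc (¬ R) (¬ T) (¬ U)))
           (⅋̇-cong (id , id) (ᗮᗮ-intro , ⅋̇-fact {⟦ ¬ T ⟧} {⟦ ¬ U ⟧}))))
⟦⟧-≈ (⊗-comm R T) = ᗮ-cong (⟦⟧-≈ (⅋-comm (¬ R) (¬ T)))
⟦⟧-≈ (¬-⅋ R T) = ᗮ-cong (⅋̇-cong (≐-sym (ᗮᗮ-≐ R)) (≐-sym (ᗮᗮ-≐ T)))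
⟦⟧-≈ (¬-⊗ R T) = ⅋̇-fact {⟦ ¬ R ⟧} {⟦ ¬ T ⟧} , ᗮᗮ-intro
⟦⟧-≈ (¬-¬ R) = ᗮᗮ-≐ R
⟦⟧-≈ ¬-⊥ = id , id
⟦⟧-≈ ¬-𝟏 = Pole-fact , ᗮᗮ-intro

context-mono : ∀ S {R T} → ⟦ R ⟧ ⊆ ⟦ T ⟧ → ⟦ S [ R ] ⟧ ⊆ ⟦ S [ T ] ⟧
context-mono ∙        R⊆T = R⊆T
context-mono (S ⅋ˡ _) R⊆T {x} x∈ = ⅋̇-mono (context-mono S R⊆T) id {x} x∈
context-mono (S ⊗ˡ _) R⊆T = ⊗̇-mono (context-mono S R⊆T) id
context-mono (_ ⅋ʳ S) R⊆T {x} x∈ = ⅋̇-mono id (context-mono S R⊆T) {x} x∈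
context-mono (_ ⊗ʳ S) R⊆T = ⊗̇-mono id (context-mono S R⊆T)

rule-sound : ∀ {P Q} → (MLSdli ∪ AtomicCut) P Q → ⟦ P ⟧ ⊆ ⟦ Q ⟧
rule-sound (inj₁ (ai↓ S a)) = context-mono S
  (𝟏̇-least (⅋̇-fact {⟦ ⌜ a ⌝ ⟧}) (excluded-middle {⟦ ⌜ a ⌝ ⟧}))
rule-sound (inj₁ (u₁↓ S R)) = context-mono S (⅋̇-identityʳ⁻ {⟦ R ⟧})
rule-sound (inj₁ (u₂↓ S R)) = context-mono S (⊗̇-identityʳ⁻ {⟦ R ⟧})
rule-sound (inj₁ (dlis S R T U _ _ _)) = context-mono S (switch {⟦ U ⟧} {⟦ R ⟧} {⟦ T ⟧})
rule-sound (inj₂ (ai↑ S R a)) = context-mono S (⅋̇-cut {⟦ R ⟧} {⟦ ⌜ a ⌝ ⟧} (⟦⟧-fact R))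

derivation-sound : ∀ {P Q} → Derivation (MLSdli ∪ AtomicCut) P Q → ⟦ P ⟧ ⊆ ⟦ Q ⟧
derivation-sound (stop e)     = proj₁ (⟦⟧-≈ e)
derivation-sound (step e r d) = derivation-sound d ∘ rule-sound r ∘ proj₁ (⟦⟧-≈ e)

components∈Focusᗮ : ∀ A → (Focus A ᗮ) (components A)
components∈Focusᗮ (atom _)  unit       = unit
components∈Focusᗮ (atom _)  (blur _ d) = d
components∈Focusᗮ (par _ _) (blur _ d) = d
components∈Focusᗮ (cop _ _) f          = focus f

commute : ∀ Γ Δ → ⊢ Γ ++ Δ → ⊢ Δ ++ Γ
commute Γ Δ = perm (↭.++-comm Γ Δ)

mutual
  -- Okada's lemma for focused proofs. For passive formulas the sequent itself lies in `Focus A`, by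
  -- `blur`. For a copar its side formulas need not split between the two factors, so only
  -- membership in the closure is claimed.
  ⟦⟧⊆Focusᗮᗮ : ∀ A → ⟦ str A ⟧ ⊆ Focus A ᗮ ᗮ
  ⟦⟧⊆Focusᗮᗮ (atom (pos n)) x∈ = ᗮᗮ-intro (blur (atom λ ()) (commute _ (atom (pos n) ∷ []) (x∈ refl)))
  ⟦⟧⊆Focusᗮᗮ (atom (neg n)) x∈ = ᗮᗮ-intro (blur (atom λ ())
    (commute _ (atom (neg n) ∷ []) (x∈ λ { refl → perm (swap _ _ ↭-refl) (ax n) })))
  ⟦⟧⊆Focusᗮᗮ (atom one) x∈ y∈ = x∈ (perm (↭.++-identityʳ _) (y∈ unit))
  ⟦⟧⊆Focusᗮᗮ (atom bot) x∈ = ᗮᗮ-intro (blur (atom λ ()) (bot x∈))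
  ⟦⟧⊆Focusᗮᗮ (par A B) x∈ = ᗮᗮ-intro (blur par
    (commute _ (components A ++ components B) (x∈ (components∈⟦⟧ᗮ A) (components∈⟦⟧ᗮ B))))
  ⟦⟧⊆Focusᗮᗮ (cop A B) = ⊗̇-elim split (⟦⟧⊆Focusᗮᗮ A) (⟦⟧⊆Focusᗮᗮ B)

  components∈⟦⟧ᗮ : ∀ A → (⟦ str A ⟧ ᗮ) (components A)
  components∈⟦⟧ᗮ A x∈ = ᗮᗮ-intro {Focus A ᗮ} (components∈Focusᗮ A) (⟦⟧⊆Focusᗮᗮ A x∈)

⟦_⟧* : Sequent → List Region
⟦_⟧* = map (⟦_⟧ ∘ str)

Valid-sound : Valid Γ → ⊩ ⟦ Γ ⟧*
Valid-sound (perm p v) = ⊩-↭ (↭.map⁺ (⟦_⟧ ∘ str) p) (Valid-sound v)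
Valid-sound (conv e v) = ⊩-mono (proj₁ (⟦⟧-≈ e)) (Valid-sound v)
Valid-sound (ax n)     = ⊩-excluded-middle
Valid-sound unit       = ⊩-𝟏̇
Valid-sound (bot v)    = ⊩-Pole⁺ (Valid-sound v)
Valid-sound (unbot v)  = ⊩-Pole⁻ (Valid-sound v)
Valid-sound (par v)    = ⊩-⅋̇ (Valid-sound v)
Valid-sound (tensor {Γ = Γ} {Δ = Δ} v w) =
  subst (λ Xs → ⊩ _ ∷ Xs) (≡.sym (map-++ _ Γ Δ)) (⊩-⊗̇ (Valid-sound v) (Valid-sound w))

⟦⟧-complete : ∀ A → ⟦ str A ⟧ [] → ⊢ components A
⟦⟧-complete A x∈ = perm (↭.++-identityʳ _) (components∈⟦⟧ᗮ A x∈)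

-- The detour through the model removes `conv` and `unbot` and restores the focused order of rules,
-- with no permutation of proofs.
Valid⇒⊢ : Valid (A ∷ []) → ⊢ components A
Valid⇒⊢ {A} v = ⟦⟧-complete A (⊩-element (⟦⟧-fact (str A)) (Valid-sound v))

-- Measured derivations

size : Str → ℕ
size (var _) = 1
size 𝟏       = 1
size ⊥       = 1
size (R ⅋ T) = size R + size T
size (R ⊗ T) = size R + size T
size (¬ R)   = size R

-- pars R counts the atoms of R and the unordered pairs of atoms of R in the
-- par relation; tens is its dual.

mutual
  pars : Str → ℕ
  pars (R ⅋ T) = pars R + pars T + size R * size T
  pars (R ⊗ T) = pars R + pars T
  pars (¬ R)   = tens R
  pars _       = 1

  tens : Str → ℕ
  tens (R ⅋ T) = tens R + tens T
  tens (R ⊗ T) = tens R + tens T + size R * size T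
  tens (¬ R)   = pars R
  tens _       = 1

measure : Str → ℕ × ℕ × ℕ
measure R = size R , pars R , tens R

assoc-pairs : ∀ p q r a b c → (p + q + a * b) + r + (a + b) * c ≡ p + (q + r + b * c) + a * (b + c)
assoc-pairs = solve-∀

-- Negation exchanges `pars` and `tens`, and the pair counts multiply sizes, so all three invariants
-- are proved at once.
measure-≈ : ∀ {R T} → R ≈ T → measure R ≡ measure T
measure-≈ ≈-refl = refl
measure-≈ (≈-sym e) = ≡.sym (measure-≈ e)
measure-≈ (≈-trans e e′) = ≡.trans (measure-≈ e) (measure-≈ e′)
measure-≈ (⅋-cong e e′) = cong₂
  (λ { (s , p , t) (s′ , p′ , t′) → s + s′ , p + p′ + s * s′ , t + t′ }) (measure-≈ e) (measure-≈ e′)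
measure-≈ (⊗-cong e e′) = cong₂
  (λ { (s , p , t) (s′ , p′ , t′) → s + s′ , p + p′ , t + t′ + s * s′ }) (measure-≈ e) (measure-≈ e′)
measure-≈ (¬-cong e) = cong (λ { (s , p , t) → s , t , p }) (measure-≈ e)
measure-≈ (⅋-assoc R T U) = cong₂ _,_ (ℕ.+-assoc (size R) _ _)
  (cong₂ _,_ (assoc-pairs (pars R) (pars T) (pars U) (size R) _ _) (ℕ.+-assoc (tens R) _ _))
measure-≈ (⅋-comm R T) = cong₂ _,_ (ℕ.+-comm (size R) _)
  (cong₂ _,_ (cong₂ _+_ (ℕ.+-comm (pars R) _) (ℕ.*-comm (size R) _)) (ℕ.+-comm (tens R) _))
measure-≈ (⊗-assoc R T U) = cong₂ _,_ (ℕ.+-assoc (size R) _ _)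
  (cong₂ _,_ (ℕ.+-assoc (pars R) _ _) (assoc-pairs (tens R) (tens T) (tens U) (size R) _ _))
measure-≈ (⊗-comm R T) = cong₂ _,_ (ℕ.+-comm (size R) _)
  (cong₂ _,_ (ℕ.+-comm (pars R) _) (cong₂ _+_ (ℕ.+-comm (tens R) _) (ℕ.*-comm (size R) _)))
measure-≈ (¬-⅋ R T) = refl
measure-≈ (¬-⊗ R T) = refl
measure-≈ (¬-¬ R) = refl
measure-≈ ¬-⊥ = refl
measure-≈ ¬-𝟏 = refl

size>0 : ∀ R → 0 < size R
size>0 (var _) = ℕ.≤-refl
size>0 𝟏       = ℕ.≤-refl
size>0 ⊥       = ℕ.≤-refl
size>0 (R ⅋ T) = ℕ.≤-trans (size>0 R) (ℕ.m≤m+n _ _)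
size>0 (R ⊗ T) = ℕ.≤-trans (size>0 R) (ℕ.m≤m+n _ _)
size>0 (¬ R)   = size>0 R

≈-derivation : ∀ {𝒮 P P′ Q} → P ≈ P′ → Derivation 𝒮 P′ Q → Derivation 𝒮 P Q
≈-derivation e (stop e′)      = stop (≈-trans e e′)
≈-derivation e (step e′ r d) = step (≈-trans e e′) r d

_◅◅_ : ∀ {𝒮 P Q R} → Derivation 𝒮 P Q → Derivation 𝒮 Q R → Derivation 𝒮 P R
stop e     ◅◅ d′ = ≈-derivation e d′
step e r d ◅◅ d′ = step e r (d ◅◅ d′)

⅋-rule : ∀ {P Q} T → MLSdli P Q → MLSdli (P ⅋ T) (Q ⅋ T)
⅋-rule T (ai↓ S a)            = ai↓ (S ⅋ˡ T) a
⅋-rule T (u₁↓ S R)            = u₁↓ (S ⅋ˡ T) R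
⅋-rule T (u₂↓ S R)            = u₂↓ (S ⅋ˡ T) R
⅋-rule T (dlis S R V U i u r) = dlis (S ⅋ˡ T) R V U i u r

⊗-rule : ∀ {P Q} T → MLSdli P Q → MLSdli (P ⊗ T) (Q ⊗ T)
⊗-rule T (ai↓ S a)            = ai↓ (S ⊗ˡ T) a
⊗-rule T (u₁↓ S R)            = u₁↓ (S ⊗ˡ T) R
⊗-rule T (u₂↓ S R)            = u₂↓ (S ⊗ˡ T) R
⊗-rule T (dlis S R V U i u r) = dlis (S ⊗ˡ T) R V U i u r

⅋-derivation : ∀ {P Q} T → Derivation MLSdli P Q → Derivation MLSdli (P ⅋ T) (Q ⅋ T)
⅋-derivation T (stop e)     = stop (⅋-cong e ≈-refl)
⅋-derivation T (step e r d) = step (⅋-cong e ≈-refl) (⅋-rule T r) (⅋-derivation T d)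

⊗-derivation : ∀ {P Q} T → Derivation MLSdli P Q → Derivation MLSdli (P ⊗ T) (Q ⊗ T)
⊗-derivation T (stop e)     = stop (⊗-cong e ≈-refl)
⊗-derivation T (step e r d) = step (⊗-cong e ≈-refl) (⊗-rule T r) (⊗-derivation T d)

infix 4 _⟶_

-- The bound on sizes makes the relation stable under par with a context `T`, where `pars` also
-- counts the pairs between the structure and `T`.
record _⟶_ (P Q : Str) : Set where
  field
    derivation : Derivation MLSdli P Q
    size-≤     : size P ≤ size Q
    pars-<     : pars P < pars Q

open _⟶_

rule-step : ∀ {P Q} → MLSdli P Q → size P ≤ size Q → pars P < pars Q → P ⟶ Q
rule-step r s p = record { derivation = step ≈-refl r (stop ≈-refl) ; size-≤ = s ; pars-< = p }

⟶-respʳ-≈ : ∀ {P Q Q′} → Q ≈ Q′ → P ⟶ Q → P ⟶ Q′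
⟶-respʳ-≈ e s with measure-≈ e
... | eq = record
  { derivation = derivation s ◅◅ stop e
  ; size-≤     = subst (_ ≤_) (cong proj₁ eq) (size-≤ s)
  ; pars-<     = subst (_ <_) (cong (proj₁ ∘ proj₂) eq) (pars-< s)
  }

⟶-⅋ : ∀ {P Q} T → P ⟶ Q → P ⅋ T ⟶ Q ⅋ T
⟶-⅋ T s = record
  { derivation = ⅋-derivation T (derivation s)
  ; size-≤     = ℕ.+-monoˡ-≤ (size T) (size-≤ s)
  ; pars-<     = ℕ.+-mono-<-≤ (ℕ.+-monoˡ-< (pars T) (pars-< s)) (ℕ.*-monoˡ-≤ (size T) (size-≤ s))
  }

⟶-⊗ : ∀ {P Q} T → P ⟶ Q → P ⊗ T ⟶ Q ⊗ T
⟶-⊗ T s = record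
  { derivation = ⊗-derivation T (derivation s)
  ; size-≤     = ℕ.+-monoˡ-≤ (size T) (size-≤ s)
  ; pars-<     = ℕ.+-monoˡ-< (pars T) (pars-< s)
  }

ai-step : ∀ n → 𝟏 ⟶ var n ⅋ ¬ var n
ai-step n = rule-step (ai↓ ∙ (pos n)) (ℕ.n≤1+n 1) (ℕ.m≤n⇒m≤1+n (ℕ.n<1+n 1))

u₁-step : ∀ R → R ⟶ ⊥ ⅋ R
u₁-step R = ⟶-respʳ-≈ (⅋-comm R ⊥)
  (rule-step (u₁↓ ∙ R) (ℕ.m≤m+n _ _) (ℕ.≤-trans (ℕ.m<m+n (pars R) z<s) (ℕ.m≤m+n _ _)))

-- The par pairs are the same on both sides; the strict decrease comes from the atoms, which `pars`
-- counts as well.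
u₂-step : ∀ R → R ⟶ 𝟏 ⊗ R
u₂-step R = ⟶-respʳ-≈ (⊗-comm R 𝟏) (rule-step (u₂↓ ∙ R) (ℕ.m≤m+n _ _) (ℕ.m<m+n (pars R) z<s))

-- Interaction and the lazy switch

data Interact (A B : NNF) : Set where
  via : ∀ a → atoms A a → atoms B (dual a) → Interact A B

dual-involutive : ∀ a → dual (dual a) ≡ a
dual-involutive (pos _) = refl
dual-involutive (neg _) = refl
dual-involutive one     = refl
dual-involutive bot     = refl

Interact-sym : Interact A B → Interact B A
Interact-sym {A} (via a a∈A a∈B) = via (dual a) a∈B (subst (atoms A) (≡.sym (dual-involutive a)) a∈A)

atoms-negate : ∀ A {a} → atoms A (dual a) → atoms (negate A) a
atoms-negate (atom _) refl = dual-involutive _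
atoms-negate (par A B) (inj₁ x) = inj₁ (atoms-negate A x)
atoms-negate (par A B) (inj₂ x) = inj₂ (atoms-negate B x)
atoms-negate (cop A B) (inj₁ x) = inj₁ (atoms-negate A x)
atoms-negate (cop A B) (inj₂ x) = inj₂ (atoms-negate B x)

nnf-str : ∀ A → nnf (str A) ≡ A
nnf-str (atom (pos _)) = refl
nnf-str (atom (neg _)) = refl
nnf-str (atom one)     = refl
nnf-str (atom bot)     = refl
nnf-str (par A B)      = cong₂ par (nnf-str A) (nnf-str B)
nnf-str (cop A B)      = cong₂ cop (nnf-str A) (nnf-str B)

-- The formulas of focused sequents. Apart from `atom bot`, these are the shapes that `dlis` admits
-- for `U`.
data Active : Pred NNF 0ℓ where
  atom : ∀ {a} → Active (atom a)
  cop  : Active (cop A B)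

-- Read upwards, the switch takes the pairs between `U` and `Q` out of the par relation. There is at
-- least one, since both structures have positive size.
dlis-step : Interact U P → Active U → U ≢ atom bot → Passive P →
            (str U ⅋ str P) ⊗ str Q ⟶ str U ⅋ (str P ⊗ str Q)
dlis-step {U} {P} {Q} (via a a∈U a∈P) active U≢⊥ passive = rule-step
  (dlis ∙ (str P) (str Q) (str U)
    (a , subst (λ A → atoms (negate A) a) (≡.sym (nnf-str P)) (atoms-negate P a∈P)
       , subst (λ A → atoms A a) (≡.sym (nnf-str U)) a∈U)
    (U-side active U≢⊥) (P-side passive))
  (ℕ.≤-reflexive (ℕ.+-assoc (size (str U)) _ _))
  (pairs (pars (str U)) (pars (str P)) (pars (str Q)) (size>0 (str U)) (size>0 (str Q)))
  where
  U-side : ∀ {U} → Active U → U ≢ atom bot → IsCopar (str U) ⊎ IsAtomOtherThan bot (str U)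
  U-side (atom {a}) U≢⊥ = inj₂ (a , U≢⊥ ∘ cong atom , ≈-refl)
  U-side (cop {A} {B}) _ = inj₁ (str A , str B , ≈-refl)

  P-side : ∀ {P} → Passive P → IsPar (str P) ⊎ IsAtomOtherThan one (str P)
  P-side (atom {a} a≢1) = inj₂ (a , a≢1 , ≈-refl)
  P-side (par {A} {B})  = inj₁ (str A , str B , ≈-refl)

  regroup : ∀ p q r a b c → (p + q + a * b) + r + a * c ≡ p + (q + r) + a * (b + c)
  regroup = solve-∀

  pairs : ∀ p q r {a b c} → 0 < a → 0 < c → (p + q + a * b) + r < p + (q + r) + a * (b + c)
  pairs p q r {suc a} {b} {suc c} _ _ =
    subst (p + q + suc a * b + r <_) (regroup p q r (suc a) b (suc c)) (ℕ.m<m+n _ z<s)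

-- Progress on coloured sequents

Coloured : Set
Coloured = List (ℕ × NNF)

∣_∣ : Coloured → Sequent
∣_∣ = map proj₂

paint : ℕ → Sequent → Coloured
paint c = map (c ,_)

private variable
  c d : ℕ
  Φ Ψ Ω : Coloured

-- Nesting to the left keeps the first formula innermost: a step on it lifts through the list, and
-- appending lists is iterating `join`.
join : NNF → Sequent → NNF
join = foldl par

join-cong : ∀ Γ → str A ≈ str B → str (join A Γ) ≈ str (join B Γ)
join-cong []      e = e
join-cong (_ ∷ Γ) e = join-cong Γ (⅋-cong e ≈-refl)

join-⟶ : ∀ Γ → str A ⟶ str B → str (join A Γ) ⟶ str (join B Γ)
join-⟶ []      s = s
join-⟶ (F ∷ Γ) s = join-⟶ Γ (⟶-⅋ (str F) s)

join-valid : ∀ Γ → Valid (A ∷ Γ ++ Δ) → Valid (join A Γ ∷ Δ)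
join-valid []      v = v
join-valid (_ ∷ Γ) v = join-valid Γ (par v)

⅋-exchange : ∀ R T U → (R ⅋ T) ⅋ U ≈ (R ⅋ U) ⅋ T
⅋-exchange R T U = ≈-trans (⅋-assoc R T U) (≈-trans (⅋-cong ≈-refl (⅋-comm T U)) (≈-sym (⅋-assoc R U T)))

join-↭ : Γ ↭ Δ → str (join A Γ) ≈ str (join A Δ)
join-↭ refl                = ≈-refl
join-↭ (prep _ p)          = join-↭ p
join-↭ {A = A} (swap {xs = Γ} F G p) =
  ≈-trans (join-cong Γ (⅋-exchange (str A) (str F) (str G))) (join-↭ p)
join-↭ (trans p q)         = ≈-trans (join-↭ p) (join-↭ q)

join-↭′ : F ∷ Γ ↭ G ∷ Δ → str (join F Γ) ≈ str (join G Δ)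
join-↭′ {F} {Γ} {G} p with ∈-∃++ (∈-resp-↭ (↭-sym p) (here refl))
... | []    , _  , refl = join-↭ (drop-∷ p)
... | _ ∷ Θ , Θ′ , refl =
  ≈-trans (join-↭ (shift G Θ Θ′)) (≈-trans (join-cong (Θ ++ Θ′) (⅋-comm (str F) (str G)))
    (join-↭ (drop-∷ (↭-trans (↭-sym (shift G (F ∷ Θ) Θ′)) p))))

join-components : ∀ A B → str (join A (components B)) ≈ str A ⅋ str B
join-components A (atom _)  = ≈-refl
join-components A (cop _ _) = ≈-refl
join-components A (par B C) rewrite foldl-++ par A (components B) (components C) =
  ≈-trans (join-components (join A (components B)) C)
    (≈-trans (⅋-cong (join-components A B) ≈-refl) (⅋-assoc (str A) (str B) (str C)))

components-join : ∀ A → ∃[ F ] ∃[ Γ ] components A ≡ F ∷ Γ × str A ≈ str (join F Γ)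
components-join (atom _)  = _ , _ , refl , ≈-refl
components-join (cop _ _) = _ , _ , refl , ≈-refl
components-join (par A B) with components-join A
... | F , Γ , eq , A≈ = F , Γ ++ components B , cong (_++ components B) eq ,
  subst (λ X → str (par A B) ≈ str X) (≡.sym (foldl-++ par F Γ (components B)))
    (≈-trans (⅋-cong A≈ ≈-refl) (≈-sym (join-components (join F Γ) B)))

-- Up to `≈`, `P` is the par of its components in any order, so a rule on some of them is a rule on
-- `P` with the others as context.
join-reduct : components P ↭ F ∷ Γ ++ Δ → str X ⟶ str (join F Γ) → str (join X Δ) ⟶ str P
join-reduct {P} {F} {Γ} {Δ} p s with components-join P
... | G , Θ , eq , P≈ = ⟶-respʳ-≈
  (≈-trans (join-↭′ (subst (F ∷ Γ ++ Δ ↭_) eq (↭-sym p))) (≈-sym P≈))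
  (subst (λ Y → _ ⟶ str Y) (≡.sym (foldl-++ par F Γ Δ)) (join-⟶ Δ s))

components-one : ∀ P → components P ++ Γ ≡ atom one ∷ [] → P ≡ atom one
components-one (atom _) refl = refl
-- Each half of a par has a first component, so a par has at least two components.
components-one (par A B) eq with components A | components-join A | components B | components-join B
components-one (par A B) () | _ ∷ [] | _ , _ , refl , _ | _ | _ , _ , refl , _
components-one (par A B) () | _ ∷ _ ∷ _ | _ | _ | _

components-atoms : ∀ P {a} → U ∈ components P → atoms U a → atoms P a
components-atoms (atom _)  (here refl) x = x
components-atoms (cop _ _) (here refl) x = x
components-atoms (par A B) i x with ∈-++⁻ (components A) i
... | inj₁ i = inj₁ (components-atoms A i x)
... | inj₂ i = inj₂ (components-atoms B i x)

components-active : ∀ P → All Active (components P)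
components-active (atom _)  = atom ∷ []
components-active (cop _ _) = cop ∷ []
components-active (par A B) = All.++⁺ (components-active A) (components-active B)

mutual
  ⊢-active : ⊢ Γ → All Active Γ
  ⊢-active (perm p d) = All-resp-↭ p (⊢-active d)
  ⊢-active (ax _)     = atom ∷ atom ∷ []
  ⊢-active unit       = atom ∷ []
  ⊢-active (bot d)    = atom ∷ ⊢-active d
  ⊢-active (focus f)  = cop ∷ Focus-active f

  Focus-active : Focus A Γ → All Active Γ
  Focus-active unit            = []
  Focus-active (split f g)     = All.++⁺ (Focus-active f) (Focus-active g)
  Focus-active (blur {A} _ d)  = All.++⁻ʳ (components A) (⊢-active d)

-- Clashes and reducts

data Clash (Φ : Coloured) : Set where
  clash : (c , U) ∈ Φ → (d , P) ∈ Φ → c ≢ d → Interact U P → Clash Φ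

-- `F ∷ Γ` is the group of one colour to which a rule applies, with premise `X`. `Δ` holds formulas
-- without a colour: none for a whole sequent, the pending copar during focusing.
data Reduct (Δ : Sequent) (Φ : Coloured) : Set where
  reduct : Φ ↭ paint c (F ∷ Γ) ++ Ψ → str X ⟶ str (join F Γ) → Valid (X ∷ Δ ++ ∣ Ψ ∣) → Reduct Δ Φ

data Outcome (Φ : Coloured) : Set where
  unit   : Φ ≡ (c , atom one) ∷ [] → Outcome Φ
  clash  : Clash Φ → Outcome Φ
  reduct : Reduct [] Φ → Outcome Φ

-- K is a copar to which no colour has been assigned yet.

data FocusOutcome (K : NNF) (Φ : Coloured) : Set where
  clash  : Clash Φ → FocusOutcome K Φ
  outer  : Reduct (K ∷ []) Φ → FocusOutcome K Φ
  inner  : str X ⟶ str K → Valid (X ∷ ∣ Φ ∣) → FocusOutcome K Φ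
  absorb : Φ ↭ (c , U) ∷ Ψ → Interact U K → str X ⟶ str (par U K) → Valid (X ∷ ∣ Ψ ∣) → FocusOutcome K Φ

∣∣-++ : ∀ Φ Ψ → ∣ Φ ++ Ψ ∣ ≡ ∣ Φ ∣ ++ ∣ Ψ ∣
∣∣-++ = map-++ proj₂

∣paint∣ : ∀ c Γ → ∣ paint c Γ ∣ ≡ Γ
∣paint∣ c Γ = ≡.trans (≡.sym (map-∘ Γ)) (map-id Γ)

-- `lift` frees the colour 0 for a new group. `unlift` is applied only to lifted colours, so `pred`
-- never meets 0.
lift unlift : Coloured → Coloured
lift   = map (map₁ suc)
unlift = map (map₁ pred)

∣lift∣ : ∀ Φ → ∣ lift Φ ∣ ≡ ∣ Φ ∣
∣lift∣ Φ = ≡.sym (map-∘ Φ)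

∣unlift∣ : ∀ Φ → ∣ unlift Φ ∣ ≡ ∣ Φ ∣
∣unlift∣ Φ = ≡.sym (map-∘ Φ)

unlift-lift : ∀ Φ → unlift (lift Φ) ≡ Φ
unlift-lift Φ = ≡.trans (≡.sym (map-∘ Φ)) (map-id Φ)

unlift-paint : ∀ Γ → unlift (paint (suc c) Γ) ≡ paint c Γ
unlift-paint Γ = ≡.sym (map-∘ Γ)

∈-paint : (c , U) ∈ paint d Γ → c ≡ d × U ∈ Γ
∈-paint i with ∈-map⁻ _ i
... | _ , U∈Γ , refl = refl , U∈Γ

∈-lift : (c , U) ∈ lift Φ → ∃[ d ] c ≡ suc d × (d , U) ∈ Φ
∈-lift i with ∈-map⁻ _ i
... | (d , _) , j , refl = d , refl , j

paint∩lift : ∀ {x} → x ∈ paint 0 Γ → x ∉ lift Φ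
paint∩lift i j with ∈-paint i | ∈-lift j
... | refl , _ | _ , () , _

paint∩paint : ∀ {x} → c ≢ d → x ∈ paint c Γ → x ∉ paint d Δ
paint∩paint c≢d i j with ∈-paint i | ∈-paint j
... | refl , _ | refl , _ = c≢d refl

∣∣-split : ∀ Γ {Δ} Φ → ∣ Φ ∣ ≡ Γ ++ Δ → ∃[ Ψ ] ∃[ Ω ] Φ ≡ Ψ ++ Ω × ∣ Ψ ∣ ≡ Γ × ∣ Ω ∣ ≡ Δ
∣∣-split []      Φ       eq = [] , Φ , refl , refl , eq
∣∣-split (_ ∷ Γ) (x ∷ Φ) eq with ∷-injective eq
... | refl , eq′ with ∣∣-split Γ Φ eq′
... | Ψ , Ω , refl , refl , refl = x ∷ Ψ , Ω , refl , refl , refl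

-- Elements of `ls` cannot come from `ys`, so they are taken one by one out of `xs`, leaving `ws`.
-- With `ls` a group of one colour, this places the whole group inside the decomposed factor or
-- among its side formulas.
↭-partition : ∀ {A : Set} (ls : List A) {xs ys zs} → (∀ {x} → x ∈ ls → x ∉ ys) →
              xs ++ ys ↭ ls ++ zs → ∃[ ws ] xs ↭ ls ++ ws × zs ↭ ws ++ ys
↭-partition []       {xs} _        p = xs , refl , ↭-sym p
↭-partition (l ∷ ls) {xs} {ys} disjoint p with ∈-++⁻ xs (∈-resp-↭ (↭-sym p) (here refl))
... | inj₂ l∈ys = contradiction l∈ys (disjoint (here refl))
... | inj₁ l∈xs with ∈-∃++ l∈xs
... | as , bs , refl with ↭-partition ls {as ++ bs} {ys} (disjoint ∘ there)
  (drop-∷ (↭-trans (↭-sym (++⁺ʳ ys (shift l as bs))) p))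
... | ws , q , r = ws , ↭-trans (shift l as bs) (prep l q) , r

Outcome-resp-↭ : Φ ↭ Ψ → Outcome Φ → Outcome Ψ
Outcome-resp-↭ p (unit refl)            = unit (↭-singleton-inv (↭-sym p))
Outcome-resp-↭ p (clash (clash i j n x)) = clash (clash (∈-resp-↭ p i) (∈-resp-↭ p j) n x)
Outcome-resp-↭ p (reduct (reduct q s v)) = reduct (reduct (↭-trans (↭-sym p) q) s v)

FocusOutcome-resp-≈ : str P ≈ str Q → (∀ {U} → Interact U P → Interact U Q) →
                      FocusOutcome P Φ → FocusOutcome Q Φ
FocusOutcome-resp-≈ e f (clash x)          = clash x
FocusOutcome-resp-≈ e f (outer (reduct p s v)) =
  outer (reduct p s (perm (swap _ _ refl) (conv e (perm (swap _ _ refl) v))))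
FocusOutcome-resp-≈ e f (inner s v)        = inner (⟶-respʳ-≈ e s) v
FocusOutcome-resp-≈ e f (absorb p x s v)   = absorb p (f x) (⟶-respʳ-≈ (⅋-cong ≈-refl e) s) v

Interact-cop : Interact U P → Interact U (cop P Q)
Interact-cop (via a a∈U a∈P) = via a a∈U (inj₁ a∈P)

Interact-assoc : Interact U (cop P (cop Q R)) → Interact U (cop (cop P Q) R)
Interact-assoc (via a a∈U (inj₁ x))        = via a a∈U (inj₁ (inj₁ x))
Interact-assoc (via a a∈U (inj₂ (inj₁ x))) = via a a∈U (inj₁ (inj₂ x))
Interact-assoc (via a a∈U (inj₂ (inj₂ x))) = via a a∈U (inj₂ x)

bot? : ∀ (U : NNF) → Dec (U ≡ atom bot)
bot? (atom bot)     = yes refl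
bot? (atom (pos _)) = no λ ()
bot? (atom (neg _)) = no λ ()
bot? (atom one)     = no λ ()
bot? (par _ _)      = no λ ()
bot? (cop _ _)      = no λ ()

absorb-reduct : Active U → Passive P → Interact U P → Valid (P ∷ U ∷ Γ) → Valid (Q ∷ Δ) →
                ∃[ X ] str X ⟶ str (par U (cop P Q)) × Valid (X ∷ Γ ++ Δ)
absorb-reduct {U} {P} {Q = Q} a p i v w with bot? U
-- `dlis` excludes `⊥` as `U`; here `⊥` is erased by `u₁↓` instead.
... | yes refl = cop P Q , u₁-step _ , tensor (unbot (perm (swap _ _ refl) v)) w
... | no U≢⊥   = cop (par U P) Q , dlis-step {Q = Q} i a U≢⊥ p , tensor (par (perm (swap _ _ refl) v)) w

absorb-at : (c , U) ∈ Φ → Active U → Passive P → Interact U P → Valid (P ∷ ∣ Φ ∣) → Valid (Q ∷ ∣ Ω ∣) →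
            FocusOutcome (cop P Q) (Φ ++ Ω)
absorb-at {c} {U} {Ω = Ω} i a p x v w with ∈-∃++ i
... | Ψ , Ψ′ , refl with absorb-reduct a p x
  (perm (prep _ (↭.map⁺ proj₂ (shift (c , U) Ψ Ψ′))) v) w
... | X , s , v′ = absorb (++⁺ʳ Ω (shift (c , U) Ψ Ψ′)) (Interact-cop x) s
  (subst (λ Γ → Valid (X ∷ Γ)) (≡.sym (∣∣-++ (Ψ ++ Ψ′) Ω)) v′)

-- The components of P are given the fresh colour 0, so every clash that
-- involves P is with a formula outside P.

blur-progress : Passive P → All Active ∣ Φ ∣ → Valid (P ∷ ∣ Φ ∣) → Valid (Q ∷ ∣ Ω ∣) →
                Outcome (paint 0 (components P) ++ lift Φ) → FocusOutcome (cop P Q) (Φ ++ Ω)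
blur-progress {P} {Φ} {Q} {Ω} p a v w (unit eq) =
  contradiction (components-one P (≡.trans (≡.sym flat) (cong ∣_∣ eq))) (not-one p)
  where
  flat : ∣ paint 0 (components P) ++ lift Φ ∣ ≡ components P ++ ∣ Φ ∣
  flat = ≡.trans (∣∣-++ (paint 0 (components P)) (lift Φ)) (cong₂ _++_ (∣paint∣ 0 _) (∣lift∣ Φ))

  not-one : ∀ {A} → Passive A → A ≢ atom one
  not-one (atom 1≢1) refl = 1≢1 refl
blur-progress {P} p a v w (clash (clash i j c≢d x@(via b b∈ b̄∈)))
  with ∈-++⁻ (paint 0 (components P)) i | ∈-++⁻ (paint 0 (components P)) j
... | inj₁ i′ | inj₁ j′ = contradiction (≡.trans (proj₁ (∈-paint i′)) (≡.sym (proj₁ (∈-paint j′)))) c≢d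
-- A component of `P` interacts with a side formula, and hence so does `P`: the case for the switch.
... | inj₁ i′ | inj₂ j′ with ∈-paint i′ | ∈-lift j′
...   | _ , U∈P | d , refl , V∈Φ = absorb-at V∈Φ (All.lookup a (∈-map⁺ proj₂ V∈Φ)) p
  (Interact-sym (via b (components-atoms P U∈P b∈) b̄∈)) v w
blur-progress {P} p a v w (clash (clash i j c≢d x@(via b b∈ b̄∈))) | inj₂ i′ | inj₁ j′ with ∈-lift i′ | ∈-paint j′
...   | c , refl , U∈Φ | _ , V∈P = absorb-at U∈Φ (All.lookup a (∈-map⁺ proj₂ U∈Φ)) p
  (via b b∈ (components-atoms P V∈P b̄∈)) v w
blur-progress {P} p a v w (clash (clash i j c≢d x)) | inj₂ i′ | inj₂ j′ with ∈-lift i′ | ∈-lift j′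
...   | c , refl , U∈Φ | d , refl , V∈Φ = clash (clash (∈-++⁺ˡ U∈Φ) (∈-++⁺ˡ V∈Φ) (c≢d ∘ cong suc) x)
-- A group of colour 0 consists of components of `P`, so the rule applies inside `P ⊗ Q`.
blur-progress {P} {Φ} {Q} {Ω} p a v w (reduct (reduct {zero} {F} {Γ} {Ψ} {X} π s u))
  with ↭-partition (paint 0 (F ∷ Γ)) {paint 0 (components P)} {lift Φ} paint∩lift π
... | Θ , σ , τ = inner {X = cop (join X ∣ Θ ∣) Q} (⟶-⊗ (str Q) (join-reduct {P} {F} {Γ} flatσ s))
  (subst (λ Δ → Valid (_ ∷ Δ)) (≡.sym (∣∣-++ Φ Ω)) (tensor (join-valid ∣ Θ ∣ (perm (prep X flatτ) u)) w))
  where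
  flatσ : components P ↭ F ∷ Γ ++ ∣ Θ ∣
  flatσ = ≡.subst₂ _↭_ (∣paint∣ 0 (components P))
    (≡.trans (∣∣-++ (paint 0 (F ∷ Γ)) Θ) (cong (_++ ∣ Θ ∣) (∣paint∣ 0 (F ∷ Γ)))) (↭.map⁺ proj₂ σ)

  flatτ : ∣ Ψ ∣ ↭ ∣ Θ ∣ ++ ∣ Φ ∣
  flatτ = subst (∣ Ψ ∣ ↭_) (≡.trans (∣∣-++ Θ (lift Φ)) (cong (∣ Θ ∣ ++_) (∣lift∣ Φ))) (↭.map⁺ proj₂ τ)
-- Here the group lies among the side formulas. `P` is reassembled from its components and `tensor`
-- restores the copar beside the premise `X`.
blur-progress {P} {Φ} {Q} {Ω} p a v w (reduct (reduct {suc c} {F} {Γ} {Ψ} {X} π s u))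
  with ↭-partition (paint (suc c) (F ∷ Γ)) {lift Φ} {paint 0 (components P)} (paint∩paint λ ())
    (↭-trans (↭.++-comm (lift Φ) _) π)
... | Θ , σ , τ = outer (reduct {Γ = Γ} {Ψ = unlift Θ ++ Ω} split′ s (subst (λ Δ → Valid (X ∷ cop P Q ∷ Δ)) flat
  (perm (swap _ _ refl) (tensor (components-valid P (perm shuffle u)) w))))
  where
  split′ : Φ ++ Ω ↭ paint c (F ∷ Γ) ++ (unlift Θ ++ Ω)
  split′ = ↭-trans (++⁺ʳ Ω (≡.subst₂ _↭_ (unlift-lift Φ)
    (≡.trans (map-++ _ (paint (suc c) (F ∷ Γ)) Θ) (cong (_++ unlift Θ) (unlift-paint (F ∷ Γ))))
    (↭.map⁺ (map₁ pred) σ))) (↭.++-assoc (paint c (F ∷ Γ)) (unlift Θ) Ω)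

  flat : ∣ Θ ∣ ++ ∣ Ω ∣ ≡ ∣ unlift Θ ++ Ω ∣
  flat = ≡.sym (≡.trans (∣∣-++ (unlift Θ) Ω) (cong (_++ ∣ Ω ∣) (∣unlift∣ Θ)))

  shuffle : X ∷ ∣ Ψ ∣ ↭ components P ++ X ∷ ∣ Θ ∣
  shuffle = ↭-trans (prep X (subst (∣ Ψ ∣ ↭_)
      (≡.trans (∣∣-++ Θ (paint 0 (components P))) (cong (∣ Θ ∣ ++_) (∣paint∣ 0 (components P))))
      (↭.map⁺ proj₂ τ)))
    (↭.++-comm (X ∷ ∣ Θ ∣) (components P))

mutual
  -- The colouring is quantified within the induction because `blur` continues with a recoloured
  -- premise.
  progress : ⊢ Γ → ∀ Φ → ∣ Φ ∣ ≡ Γ → Outcome Φ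
  progress (perm p d) Φ refl with ↭-map-inv proj₂ (↭-sym p)
  ... | Ψ , refl , q = Outcome-resp-↭ (↭-sym q) (progress d Ψ refl)
  progress (ax n) ((c , _) ∷ (d , _) ∷ []) refl with c ℕ.≟ d
  ... | yes refl = reduct (reduct {Γ = _ ∷ []} {Ψ = []} {X = atom one} refl (ai-step n) unit)
  ... | no c≢d   = clash (clash (here refl) (there (here refl)) c≢d (via (pos n) refl refl))
  progress unit (_ ∷ []) refl = unit refl
  progress (bot d) ((c , _) ∷ Φ) refl with progress d Φ refl
  ... | clash (clash i j n x) = clash (clash (there i) (there j) n x)
  ... | reduct (reduct {c′} {F} {Γ} {Ψ} {X} p s v) = reduct (reduct {Ψ = (c , _) ∷ Ψ}
    (↭-trans (prep _ p) (↭-sym (shift _ (paint c′ (F ∷ Γ)) Ψ))) s (perm (swap _ _ refl) (bot v)))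
  -- `u₁↓` needs a partner for `⊥`. The only one is `𝟏`: if their colours differ, the two units
  -- clash as dual atoms.
  ... | unit {d} refl with c ℕ.≟ d
  ...   | yes refl = reduct (reduct {Γ = _ ∷ []} {Ψ = []} {X = atom one} refl (u₁-step 𝟏) unit)
  ...   | no c≢d   = clash (clash (here refl) (there (here refl)) c≢d (via bot refl refl))
  progress (focus (blur () _))
  progress (focus (split {A} {Γ} {B} f g)) ((c , _) ∷ Φ) eq with ∷-injective eq
  ... | refl , eq′ with ∣∣-split Γ Φ eq′
  ... | Ψ , Ω , refl , refl , refl with focus-progress f Ψ refl Ω (Focus⇒Valid g)
  ... | clash (clash i j n x) = clash (clash (there i) (there j) n x)
  ... | outer (reduct {c′} {F} {Γ} {Θ} p s v) = reduct (reduct {Ψ = (c , _) ∷ Θ}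
    (↭-trans (prep _ p) (↭-sym (shift _ (paint c′ (F ∷ Γ)) Θ))) s v)
  ... | inner s v = reduct (reduct {Γ = []} refl s v)
  -- The colour of the copar enters here: it decides whether `U` may be switched into the copar or
  -- clashes with it.
  ... | absorb {d} {U} p x s v with d ℕ.≟ c
  ...   | yes refl = reduct (reduct {Γ = _ ∷ []} (↭-trans (prep _ p) (swap _ _ refl)) s v)
  ...   | no d≢c   = clash (clash (there (∈-resp-↭ (↭-sym p) (here refl))) (here refl) d≢c x)

  -- `Q` gathers, by associativity, the factors set aside so far, and `Ω` their side formulas. The
  -- leftmost factor is followed until it is `𝟏`, which `u₂↓` removes, or passive.
  focus-progress : Focus P Γ → ∀ Φ → ∣ Φ ∣ ≡ Γ → ∀ Ω → Valid (Q ∷ ∣ Ω ∣) →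
                   FocusOutcome (cop P Q) (Φ ++ Ω)
  focus-progress unit [] refl Ω w = inner (u₂-step _) w
  focus-progress {Q = R} (split {P} {Γ} {Q} {Δ} f g) Φ eq Ω w with ∣∣-split Γ Φ eq
  ... | Ψ , Ψ′ , refl , refl , refl =
    subst (FocusOutcome (cop (cop P Q) R)) (≡.sym (++-assoc Ψ Ψ′ Ω))
      (FocusOutcome-resp-≈ (≈-sym (⊗-assoc (str P) (str Q) (str R))) Interact-assoc
        (focus-progress f Ψ refl (Ψ′ ++ Ω)
          (subst (λ Γ → Valid (cop Q R ∷ Γ)) (≡.sym (∣∣-++ Ψ′ Ω)) (tensor (Focus⇒Valid g) w))))
  focus-progress {P} (blur p d) Φ refl Ω w =
    blur-progress p (All.++⁻ʳ (components P) (⊢-active d)) (components-valid P (⊢⇒Valid d)) w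
      (progress d (paint 0 (components P) ++ lift Φ)
        (≡.trans (∣∣-++ (paint 0 (components P)) (lift Φ)) (cong₂ _++_ (∣paint∣ 0 _) (∣lift∣ Φ))))

-- Cut elimination

-- With a single colour no clash can occur. The premise of a reduct is only known to be valid and
-- gets a new focused proof from `Valid⇒⊢`, so the recursion follows `pars` and not the proof.
provable : ∀ A → Acc _<_ (pars (str A)) → ⊢ components A → Proof MLSdli (str A)
provable A (acc rec) d with progress d (paint 0 (components A)) (∣paint∣ 0 _)
... | unit eq with components-one {[]} A
  (≡.trans (++-identityʳ _) (≡.trans (≡.sym (∣paint∣ 0 _)) (cong ∣_∣ eq)))
...   | refl = stop ≈-refl
provable A (acc rec) d | clash (clash i j c≢d _) with ∈-paint i | ∈-paint j
...   | refl , _ | refl , _ = contradiction refl c≢d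
provable A (acc rec) d | reduct (reduct {c} {F} {Γ} {Ψ} {X} p s v) =
  provable (join X ∣ Ψ ∣) (rec (pars-< s′)) (Valid⇒⊢ v′) ◅◅ derivation s′
  where
  flat : components A ↭ F ∷ Γ ++ ∣ Ψ ∣
  flat = ≡.subst₂ _↭_ (∣paint∣ 0 (components A))
    (≡.trans (∣∣-++ (paint c (F ∷ Γ)) Ψ) (cong (_++ ∣ Ψ ∣) (∣paint∣ c (F ∷ Γ)))) (↭.map⁺ proj₂ p)

  s′ : str (join X ∣ Ψ ∣) ⟶ str A
  s′ = join-reduct {A} {F} {Γ} flat s

  v′ : Valid (join X ∣ Ψ ∣ ∷ [])
  v′ = join-valid ∣ Ψ ∣ (subst (λ Γ → Valid (X ∷ Γ)) (≡.sym (++-identityʳ _)) v)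

-- Negation normal forms and the theorem

str-negate : ∀ A → str (negate A) ≈ ¬ str A
str-negate (atom (pos _)) = ≈-refl
str-negate (atom (neg _)) = ≈-sym (¬-¬ _)
str-negate (atom one)     = ≈-sym ¬-𝟏
str-negate (atom bot)     = ≈-sym ¬-⊥
str-negate (par A B)      = ≈-trans (⊗-cong (str-negate A) (str-negate B)) (≈-sym (¬-⅋ _ _))
str-negate (cop A B)      = ≈-trans (⅋-cong (str-negate A) (str-negate B)) (≈-sym (¬-⊗ _ _))

str-nnf : ∀ R → str (nnf R) ≈ R
str-nnf (var _) = ≈-refl
str-nnf 𝟏       = ≈-refl
str-nnf ⊥       = ≈-refl
str-nnf (R ⅋ T) = ⅋-cong (str-nnf R) (str-nnf T)
str-nnf (R ⊗ T) = ⊗-cong (str-nnf R) (str-nnf T)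
str-nnf (¬ R)   = ≈-trans (str-negate (nnf R)) (¬-cong (str-nnf R))

theorem2p36 : ∀ (R : Str) → Proof (MLSdli ∪ AtomicCut) R → Proof MLSdli R
theorem2p36 R proof =
  provable (nnf R) (<-wellFounded _)
    -- The empty sequent belongs to `⟦ 𝟏 ⟧`; soundness carries it along the derivation to `⟦ R ⟧`,
    -- where completeness reads it as a focused proof.
    (⟦⟧-complete (nnf R) (proj₂ (⟦⟧-≈ (str-nnf R)) (derivation-sound proof ε∈𝟏̇)))
  ◅◅ stop (str-nnf R)
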